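{- For every graph $G$, $\mathrm{smw}(G)=\chi(G)$.
   Context: All graphs are finite, simple and undirected; $\chi(G)$ is the chromatic number. For vertices $u,v$ of a connected graph, $I(u,v)$ is the set of vertices on shortest $(u,v)$-paths; a vertex set $S$ is convex if $I(u,v)\subseteq S$ for all $u,v\in S$. A median graph is a connected graph $M$ with $|I(u,v)\cap I(v,w)\cap I(w,u)|=1$ for all vertices $u,v,w$. A median decomposition of $G$ is a pair $(M,\mathcal{X})$ with $M$ a median graph and $\mathcal{X}=(X_a)_{a\in V(M)}$ subsets of $V(G)$ such that (M1) every edge of $G$ has both ends in some $X_a$, and (M2) for every $v\in V(G)$, $X^{ -1}(v)=\{a: v\in X_a\}$ is non-empty and convex in $M$; its width is $\max_a|X_a|$. For an edge $ab$ of $M$ let $W_{ab}=\{v\in V(M): d(v,a)<d(v,b)\}$, $U_{ab}$ the set of vertices of $W_{ab}$ with a neighbour in $W_{ba}$, and $Z_{ab}=\bigcup_{x\in U_{ab}}X_x$. The decomposition is $\Theta$-smooth if for every edge $ab\in E(M)$ we have $|Z_{ab}\setminus Z_{ba}|=|Z_{ba}\setminus Z_{ab}|=1$ and, writing $Z_{ab}\setminus Z_{ba}=\{v_a\}$ and $Z_{ba}\setminus Z_{ab}=\{v_b\}$, the set $X^{ -1}(v_a)\cup X^{ -1}(v_b)$ is convex in $M$. The smooth-medianwidth $\mathrm{smw}(G)$ is the minimum width over all $\Theta$-smooth median decompositions of $G$. -}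

module Defs where

open import Data.Nat using (ℕ; zero; suc; _≤_; _<_; _+_; _⊔_)
open import Data.Fin using (Fin)
open import Data.Fin.Subset using (Subset; _∈_; ∣_∣)
open import Data.Bool using (Bool; true; false)
open import Data.List using (foldr; map; allFin)
open import Data.Product using (Σ; ∃; ∃-syntax; _×_; _,_)
open import Data.Sum using (_⊎_)
open import Relation.Nullary using (¬_)
open import Relation.Binary.PropositionalEquality using (_≡_; _≢_)

record Graph (n : ℕ) : Set where
  field
    adj    : Fin n → Fin n → Bool
    adj-sym : ∀ u v → adj u v ≡ adj v u
    irrefl : ∀ u → adj u u ≡ false

open Graph public

Edge : ∀ {n} → Graph n → Fin n → Fin n → Set
Edge G u v = adj G u v ≡ true

data Walk {n} (G : Graph n) : Fin n → Fin n → ℕ → Set where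
  here : ∀ u → Walk G u u 0
  step : ∀ {u v w k} → Edge G u v → Walk G v w k → Walk G u w (suc k)

Dist : ∀ {n} → Graph n → Fin n → Fin n → ℕ → Set
Dist G u v k = Walk G u v k × (∀ j → Walk G u v j → k ≤ j)

Connected : ∀ {n} → Graph n → Set
Connected G = ∀ u v → ∃[ k ] Walk G u v k

InInterval : ∀ {n} → Graph n → Fin n → Fin n → Fin n → Set
InInterval G u v x =
  ∃[ k ] (Dist G u v k × ∃[ i ] ∃[ j ] (Walk G u x i × Walk G x v j × i + j ≡ k))

Convex : ∀ {n} → Graph n → (Fin n → Set) → Set
Convex G S = ∀ u v → S u → S v → ∀ x → InInterval G u v x → S x

IsMedian : ∀ {n} → Graph n → Set
IsMedian G = Connected G ×
  (∀ u v w → ∃[ z ] ((InInterval G u v z × InInterval G v w z × InInterval G w u z)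
     × (∀ z' → InInterval G u v z' → InInterval G v w z' → InInterval G w u z' → z' ≡ z)))

record MedianDecomposition {n} (G : Graph n) : Set where
  field
    m      : ℕ
    M      : Graph m
    median : IsMedian M
    X      : Fin m → Subset n
    M1     : ∀ u v → Edge G u v → ∃[ a ] (u ∈ X a × v ∈ X a)
    M2-nonempty : ∀ v → ∃[ a ] (v ∈ X a)
    M2-convex   : ∀ v → Convex M (λ a → v ∈ X a)

open MedianDecomposition public

-- width = max_a |X_a|  (0 if M has no vertices)
width : ∀ {n} {G : Graph n} → MedianDecomposition G → ℕ
width D = foldr _⊔_ 0 (map (λ a → ∣ X D a ∣) (allFin (m D)))

module _ {n} {G : Graph n} (D : MedianDecomposition G) where
  W : Fin (m D) → Fin (m D) → Fin (m D) → Set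
  W a b v = ∃[ i ] ∃[ j ] (Dist (M D) v a i × Dist (M D) v b j × i < j)

  U : Fin (m D) → Fin (m D) → Fin (m D) → Set
  U a b x = W a b x × ∃[ y ] (Edge (M D) x y × W b a y)

  Z : Fin (m D) → Fin (m D) → Fin n → Set
  Z a b v = ∃[ x ] (U a b x × v ∈ X D x)

  SingletonDiff : Fin (m D) → Fin (m D) → Fin n → Set
  SingletonDiff a b v = (Z a b v × ¬ Z b a v) × (∀ w → Z a b w → ¬ Z b a w → w ≡ v)

  ThetaSmooth : Set
  ThetaSmooth = ∀ a b → Edge (M D) a b →
    ∃[ va ] ∃[ vb ] (SingletonDiff a b va × SingletonDiff b a vb ×
      Convex (M D) (λ c → va ∈ X D c ⊎ vb ∈ X D c))

IsMinimum : (ℕ → Set) → ℕ → Set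
IsMinimum P k = P k × (∀ j → P j → k ≤ j)

SmoothWidth : ∀ {n} → Graph n → ℕ → Set
SmoothWidth G w = ∃[ D ] (ThetaSmooth {G = G} D × width D ≡ w)

Colourable : ∀ {n} → Graph n → ℕ → Set
Colourable {n} G k = Σ (Fin n → Fin k) (λ c → ∀ (u v : Fin n) → Edge G u v → c u ≢ c v)

{-# OPTIONS --safe #-}
module Submission where

-- smw(G) ≥ χ(G). Across an edge ab of M the bags differ at most by exchanging v_b for v_a. Fix a base vertex z
-- of M. A vertex v of G outside X_z enters the bags at its gate, the vertex of X⁻¹(v) nearest to z; let the parent
-- of v be the vertex it is exchanged for there on the last edge of a geodesic from z, and colour v by its
-- iterated parent in X_z. Opposite edges of a square of M have the same sides W, hence the same exchanged pair;
-- sliding an edge along squares towards the gate shows that every exchange made when moving away from z preserves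
-- the colour, so by induction on the distance to z the colouring is injective on every bag.
--
-- smw(G) ≤ χ(G). A minimal colouring is onto. Ordering each colour class as a path, let M be the product of these
-- paths and let the bag of x consist of the x_i-th vertex of class i, for every colour i.

open import Defs
import Algebra.Properties.CommutativeMonoid.Sum as ∑
open import Data.Bool using (true)
import Data.Bool.Properties as Bool
open import Data.Fin as Fin using (Fin; zero; suc; combine; finToFun; funToFin; inject≤; punchOut; quotient; remainder)
import Data.Fin.Properties as Fin
open import Data.Fin.Subset using (Subset; _∈_; ∣_∣; inside; outside)
open import Data.Fin.Subset.Properties using (_∈?_)
open import Data.List using (map; allFin)
open import Data.List.Membership.Propositional using (lose)
open import Data.List.Membership.Propositional.Properties using (∈-map⁺; ∈-allFin)
open import Data.List.Properties using (foldr-preservesᵒ; foldr-preservesᵇ)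
import Data.List.Relation.Unary.All.Properties as All
open import Data.Nat using (ℕ; zero; suc; _+_; _*_; _≤_; _<_; z≤n; s≤s; s≤s⁻¹; _<?_; _≟_; ∣_-_∣)
open import Data.Nat.Induction using (<-wellFounded)
open import Data.Nat.Properties hiding (_≟_)
open import Data.Nat.Solver using (module +-*-Solver)
open import Data.Product using (Σ; ∃-syntax; _×_; _,_; proj₁; proj₂)
open import Data.Sum as Sum using (_⊎_; inj₁; inj₂; [_,_]′)
open import Data.Vec using ([]; _∷_; here; there; tabulate)
open import Data.Vec.Functional using (Vector; updateAt)
open import Data.Vec.Functional.Properties using (updateAt-updates; updateAt-minimal)
open import Data.Vec.Properties using (lookup⇒[]=; []=⇒lookup; lookup∘tabulate)
open import Function using (_∘_; case_of_; const)
open import Function.Definitions using (Injective)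
open import Induction.WellFounded using (Acc; acc)
open import Relation.Binary.PropositionalEquality
  using (_≡_; _≢_; _≗_; refl; sym; trans; cong; cong₂; subst; ≢-sym; module ≡-Reasoning)
open import Relation.Nullary using (Dec; does; ¬_; yes; no; contradiction; ¬?)
open import Relation.Nullary.Decidable using (_×-dec_; _→-dec_; dec-true; decidable-stable; map′)
open ∑ +-0-commutativeMonoid using (sum; ∑-distrib-+; sum-cong-≗; sum-replicate-zero)

-- Median graphs

module Walks {m} (M : Graph m) where

  edge-sym : ∀ {u v} → Edge M u v → Edge M v u
  edge-sym {u} {v} e = trans (adj-sym M v u) e

  edge⇒≢ : ∀ {u v} → Edge M u v → u ≢ v
  edge⇒≢ {u} e refl = case trans (sym e) (irrefl M u) of λ ()

  walk-snoc : ∀ {u v w k} → Walk M u v k → Edge M v w → Walk M u w (suc k)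
  walk-snoc (here _)   e = step e (here _)
  walk-snoc (step f p) e = step f (walk-snoc p e)

  walk-reverse : ∀ {u v k} → Walk M u v k → Walk M v u k
  walk-reverse (here u)   = here u
  walk-reverse (step e p) = walk-snoc (walk-reverse p) (edge-sym e)

  walk-++ : ∀ {u v w k l} → Walk M u v k → Walk M v w l → Walk M u w (k + l)
  walk-++ (here _)   q = q
  walk-++ (step e p) q = step e (walk-++ p q)

-- The distance is a parameter because it arises in two ways: from the medians of a given `M`, and
-- as a sum of coordinate differences in a grid.
module Distance {m} (M : Graph m) (d : Fin m → Fin m → ℕ)
                (d-dist : ∀ u v → Dist M u v (d u v)) where

  open Walks M public

  walk : ∀ u v → Walk M u v (d u v)
  walk u v = proj₁ (d-dist u v)

  d-minimal : ∀ {u v k} → Walk M u v k → d u v ≤ k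
  d-minimal = proj₂ (d-dist _ _) _

  d-unique : ∀ {u v k} → Dist M u v k → k ≡ d u v
  d-unique (p , minimal) = ≤-antisym (minimal _ (walk _ _)) (d-minimal p)

  d-refl : ∀ u → d u u ≡ 0
  d-refl u = n≤0⇒n≡0 (d-minimal (here u))

  d≡0⇒≡ : ∀ {u v} → d u v ≡ 0 → u ≡ v
  d≡0⇒≡ {u} {v} eq with d u v | walk u v
  ... | zero | here _ = refl

  d-sym : ∀ u v → d u v ≡ d v u
  d-sym u v = ≤-antisym (d-minimal (walk-reverse (walk v u)))
                        (d-minimal (walk-reverse (walk u v)))

  d-triangle : ∀ u v w → d u w ≤ d u v + d v w
  d-triangle u v w = d-minimal (walk-++ (walk u v) (walk v w))

  edge⇒d≡1 : ∀ {u v} → Edge M u v → d u v ≡ 1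
  edge⇒d≡1 {u} {v} e with d u v in eq | d-minimal (step e (here v))
  ... | zero  | _       = contradiction (d≡0⇒≡ eq) (edge⇒≢ e)
  ... | suc _ | s≤s z≤n = refl

  d≡1⇒edge : ∀ {u v} → d u v ≡ 1 → Edge M u v
  d≡1⇒edge {u} {v} eq with d u v | walk u v
  d≡1⇒edge refl | 1 | step e (here _) = e

  step-towards : ∀ {u v k} → d u v ≡ suc k → ∃[ w ] (Edge M u w × d w v ≡ k)
  step-towards {u} {v} {k} eq with d u v | walk u v | d-minimal {u} {v}
  step-towards {u} {v} {k} refl | suc k | step {v = w} e p | minimal =
    w , e , ≤-antisym (d-minimal p) (s≤s⁻¹ (minimal (step e (walk w v))))

  Between : Fin m → Fin m → Fin m → Set
  Between u x v = d u x + d x v ≡ d u v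

  interval⇒between : ∀ {u v x} → InInterval M u v x → Between u x v
  interval⇒between {u} {v} {x} (k , dist , i , j , p , q , refl) =
    ≤-antisym (subst (d u x + d x v ≤_) (d-unique dist) (+-mono-≤ (d-minimal p) (d-minimal q)))
              (d-triangle u x v)

  between⇒interval : ∀ {u x v} → Between u x v → InInterval M u v x
  between⇒interval {u} {x} {v} eq =
    d u v , d-dist u v , d u x , d x v , walk u x , walk x v , eq

  between-sym : ∀ {u x v} → Between u x v → Between v x u
  between-sym {u} {x} {v} b =
    trans (cong₂ _+_ (d-sym v x) (d-sym x u)) (trans (+-comm (d x v) (d u x)) (trans b (d-sym u v)))

  between-trans : ∀ {u x y v} → Between u y v → Between u x y → Between u x v
  between-trans {u} {x} {y} {v} uyv uxy = ≤-antisym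
    (begin
      d u x + d x v           ≤⟨ +-monoʳ-≤ (d u x) (d-triangle x y v) ⟩
      d u x + (d x y + d y v) ≡⟨ +-assoc (d u x) _ _ ⟨
      d u x + d x y + d y v   ≡⟨ cong (_+ d y v) uxy ⟩
      d u y + d y v           ≡⟨ uyv ⟩
      d u v                   ∎)
    (d-triangle u x v)
    where open ≤-Reasoning

module Median {m} (M : Graph m) (median : IsMedian M) where

  private
    -- `InInterval` carries a `Dist`, so the median of `u`, `v`, `u` supplies the distance without a
    -- search for shortest walks.
    median-of-two : ∀ u v → ∃[ z ] InInterval M u v z
    median-of-two u v with proj₂ median u v u
    ... | z , (i , _) , _ = z , i

  d : Fin m → Fin m → ℕ
  d u v = proj₁ (proj₂ (median-of-two u v))

  d-dist : ∀ u v → Dist M u v (d u v)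
  d-dist u v = proj₁ (proj₂ (proj₂ (median-of-two u v)))

  open Distance M d d-dist public

  median-exists : ∀ u v w → ∃[ z ] (Between u z v × Between v z w × Between w z u)
  median-exists u v w with proj₂ median u v w
  ... | z , (i , j , k) , _ = z , interval⇒between i , interval⇒between j , interval⇒between k

  median-unique : ∀ {u v w y z} → Between u y v → Between v y w → Between w y u →
                  Between u z v → Between v z w → Between w z u → y ≡ z
  median-unique {u} {v} {w} a b c a' b' c' with proj₂ median u v w
  ... | _ , _ , uniq = trans (uniq _ (between⇒interval a) (between⇒interval b) (between⇒interval c))
                 (sym (uniq _ (between⇒interval a') (between⇒interval b') (between⇒interval c')))

  -- The median of `u`, `a` and `b` lies on the edge `ab`, so it is `a` or `b`; whichever end it is
  -- lies between `u` and the other.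
  bipartite : ∀ {a b} → Edge M a b → ∀ u → d u b ≡ suc (d u a) ⊎ d u a ≡ suc (d u b)
  bipartite {a} {b} e u with median-exists u a b
  ... | z , uza , azb , bzu with d a z in az | d z b in zb | trans azb (edge⇒d≡1 e)
  ... | 0 | _ | refl with refl ← d≡0⇒≡ az =
    inj₁ (trans (d-sym u b) (trans (sym bzu) (cong₂ _+_ (edge⇒d≡1 (edge-sym e)) (d-sym a u))))
  ... | 1 | 0 | refl with refl ← d≡0⇒≡ zb =
    inj₂ (trans (sym uza) (trans (cong (d u b +_) (edge⇒d≡1 (edge-sym e))) (+-comm (d u b) 1)))

  nearer : ∀ {a b} → Edge M a b → ∀ u → d u a < d u b → d u b ≡ suc (d u a)
  nearer e u lt with bipartite e u
  ... | inj₁ eq = eq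
  ... | inj₂ eq = contradiction (≤-reflexive (sym eq)) (<-asym lt)

  nearer⇒between : ∀ {a b} → Edge M a b → ∀ u → d u a < d u b → Between u a b
  nearer⇒between {a} {b} e u lt =
    trans (cong (d u a +_) (edge⇒d≡1 e)) (trans (+-comm (d u a) 1) (sym (nearer e u lt)))

  record Square (a b c e : Fin m) : Set where
    field
      ab  : Edge M a b
      bc  : Edge M b c
      ce  : Edge M c e
      ea  : Edge M e a
      a≢c : a ≢ c
      b≢e : b ≢ e

  open Square

  rotate : ∀ {a b c e} → Square a b c e → Square b c e a
  rotate s = record { ab = bc s ; bc = ce s ; ce = ea s ; ea = ab s ; a≢c = b≢e s ; b≢e = a≢c s ∘ sym }

  reflect : ∀ {a b c e} → Square a b c e → Square b a e c
  reflect s = record { ab = edge-sym (ab s) ; bc = edge-sym (ea s) ; ce = edge-sym (ce s)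
                     ; ea = edge-sym (bc s) ; a≢c = b≢e s ; b≢e = a≢c s }

  -- At distance 1 there would be a triangle, with `b` equidistant from the ends of the edge `ac`,
  -- against `bipartite`.
  d≡2 : ∀ {a b c} → Edge M a b → Edge M b c → a ≢ c → d a c ≡ 2
  d≡2 {a} {b} {c} e f a≢c with d a c in eq | d-minimal (step e (step f (here c)))
  ... | 0 | _ = contradiction (d≡0⇒≡ eq) a≢c
  ... | 1 | _ with bipartite (d≡1⇒edge eq) b
  ...   | inj₁ p = case trans (sym (edge⇒d≡1 f)) (trans p (cong suc (edge⇒d≡1 (edge-sym e)))) of λ ()
  ...   | inj₂ p = case trans (sym (edge⇒d≡1 (edge-sym e))) (trans p (cong suc (edge⇒d≡1 f))) of λ ()
  d≡2 {a} {b} {c} e f a≢c | 2 | _ = refl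
  d≡2 {a} {b} {c} e f a≢c | suc (suc (suc _)) | s≤s (s≤s ())

  midpoint : ∀ {a b c} → Edge M a b → Edge M b c → a ≢ c → Between a b c
  midpoint e f a≢c = trans (cong₂ _+_ (edge⇒d≡1 e) (edge⇒d≡1 f)) (sym (d≡2 e f a≢c))

  -- Otherwise a and c would both be medians of u, b and e.
  parallel : ∀ {a b c e} → Square a b c e → ∀ u → d u a < d u b → d u e < d u c
  parallel {a} {b} {c} {e} s u a<b with bipartite (ce s) u
  ... | inj₂ c≡1+e = ≤-reflexive (sym c≡1+e)
  ... | inj₁ e≡1+c = contradiction
    (median-unique (nearer⇒between (ab s) u a<b) (midpoint (edge-sym (ab s)) (edge-sym (ea s)) (b≢e s))
                   (between-sym u-a-e)
                   u-c-b (midpoint (bc s) (ce s) (b≢e s))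
                   (between-sym u-c-e))
    (a≢c s)
    where
    -- If `e` is farther from `u` than `c`, the side `bc` cannot lead away from `u`: `e` would be
    -- three levels above its neighbour `a`.
    levels : ∀ {A B C E} → B ≡ suc A → C ≡ suc B ⊎ B ≡ suc C → A ≡ suc E ⊎ E ≡ suc A → E ≡ suc C → C ≡ A
    levels refl (inj₂ refl) _           _    = refl
    levels refl (inj₁ refl) (inj₁ p)    refl = contradiction p (m≢1+n+m _ {3})
    levels refl (inj₁ refl) (inj₂ p)    refl = contradiction (sym (suc-injective p)) (m≢1+n+m _ {1})

    c≡a : d u c ≡ d u a
    c≡a = levels (nearer (ab s) u a<b) (bipartite (bc s) u) (bipartite (ea s) u) e≡1+c

    u-a-e : Between u a e
    u-a-e = nearer⇒between (edge-sym (ea s)) u (≤-reflexive (trans (cong suc (sym c≡a)) (sym e≡1+c)))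

    u-c-e : Between u c e
    u-c-e = nearer⇒between (ce s) u (≤-reflexive (sym e≡1+c))

    u-c-b : Between u c b
    u-c-b = nearer⇒between (edge-sym (bc s)) u
              (≤-reflexive (trans (cong suc c≡a) (sym (nearer (ab s) u a<b))))

  -- The median `w` of `y`, `y'` and `z` is equidistant from `y` and `y'`, which are at distance 2,
  -- so it is adjacent to both; it lies two levels below `x`.
  quadrangle : ∀ {x y y'} z → Edge M x y → Edge M x y' → y ≢ y' →
               d z x ≡ suc (d z y) → d z x ≡ suc (d z y') →
               ∃[ w ] (Square w y x y' × d z y ≡ suc (d z w))
  quadrangle {x} {y} {y'} z xy xy' y≢y' eq eq' with median-exists y y' z
  ... | w , ywy' , y'wz , zwy = w , square , sym zw+1
    where
    zy≡zy' : d z y ≡ d z y'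
    zy≡zy' = suc-injective (trans (sym eq) eq')

    wy≡wy' : d w y ≡ d w y'
    wy≡wy' = +-cancelˡ-≡ (d z w) _ _ (trans zwy (trans zy≡zy' (sym (between-sym y'wz))))

    halve : ∀ {k} → k + k ≡ 2 → k ≡ 1
    halve {1} refl = refl
    halve {suc (suc k)} eq = case trans (sym (+-suc k (suc k))) (suc-injective (suc-injective eq)) of λ ()

    wy≡1 : d w y ≡ 1
    wy≡1 = halve (trans (cong₂ _+_ (d-sym w y) wy≡wy')
                        (trans ywy' (d≡2 (edge-sym xy) xy' y≢y')))

    zw+1 : suc (d z w) ≡ d z y
    zw+1 = trans (+-comm 1 (d z w)) (trans (cong (d z w +_) (sym wy≡1)) zwy)

    square : Square w y x y'
    square = record
      { ab = d≡1⇒edge wy≡1 ; bc = edge-sym xy ; ce = xy'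
      ; ea = d≡1⇒edge (trans (d-sym y' w) (trans (sym wy≡wy') wy≡1))
      ; a≢c = λ { refl → m≢1+n+m _ {1} (sym (trans (cong suc zw+1) (sym eq))) }
      ; b≢e = y≢y' }

module Sides {n} {G : Graph n} (D : MedianDecomposition G)
             (d : Fin (m D) → Fin (m D) → ℕ) (d-dist : ∀ u v → Dist (M D) u v (d u v)) where

  open Distance (M D) d d-dist

  nearer⇒W : ∀ {a b v} → d v a < d v b → W D a b v
  nearer⇒W {a} {b} {v} lt = d v a , d v b , d-dist v a , d-dist v b , lt

  W⇒nearer : ∀ {a b v} → W D a b v → d v a < d v b
  W⇒nearer (_ , _ , p , q , lt) with refl ← d-unique p | refl ← d-unique q = lt

  end∈W : ∀ {a b} → Edge (M D) a b → W D a b a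
  end∈W {a} e = nearer⇒W (≤-reflexive (trans (cong suc (d-refl a)) (sym (edge⇒d≡1 e))))

-- The lower bound

module Smooth {n} {G : Graph n} (D : MedianDecomposition G) (smooth : ThetaSmooth D) where

  private
    V = Fin (m D)
    Bag = X D

  open Median (M D) (median D)
  open Square
  open Sides D d d-dist

  end∈U : ∀ {a b} → Edge (M D) a b → U D a b a
  end∈U e = end∈W e , _ , e , end∈W (edge-sym e)

  ∈⇒Z : ∀ {a b v} → Edge (M D) a b → v ∈ Bag a → Z D a b v
  ∈⇒Z e v∈a = _ , end∈U e , v∈a

  -- If `v` lay in a bag on the `b` side, `b` would be on a geodesic from there to `a`, and
  -- convexity would put `v` into the bag of `b`.
  exit⇒∉Z : ∀ {a b v} → Edge (M D) a b → v ∈ Bag a → ¬ v ∈ Bag b → ¬ Z D b a v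
  exit⇒∉Z {a} {b} {v} e v∈a v∉b (s , (s∈W , _) , v∈s) =
    v∉b (M2-convex D v s a v∈s v∈a b
      (between⇒interval (nearer⇒between (edge-sym e) s (W⇒nearer s∈W))))

  exit-unique : ∀ {a b p v} → Edge (M D) a b → SingletonDiff D a b p →
                v ∈ Bag a → ¬ v ∈ Bag b → v ≡ p
  exit-unique e (_ , uniq) v∈a v∉b = uniq _ (∈⇒Z e v∈a) (exit⇒∉Z e v∈a v∉b)

  SingletonDiff-unique : ∀ {a b p p'} → SingletonDiff D a b p → SingletonDiff D a b p' → p ≡ p'
  SingletonDiff-unique ((p∈ , p∉) , _) (_ , uniq) = uniq _ p∈ p∉

  -- Smoothness gives `p` only in some bag on the `y` side. As `y` lies between that place and `x`,
  -- convexity of the bags meeting `p` or `q` brings one of them into the bag of `y`, and it is not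
  -- `q`.
  partner : ∀ {y x q} → Edge (M D) y x → q ∈ Bag x → ¬ q ∈ Bag y →
            ∃[ p ] (SingletonDiff D y x p × p ∈ Bag y × Convex (M D) (λ c → p ∈ Bag c ⊎ q ∈ Bag c))
  partner {y} {x} {q} e q∈x q∉y with smooth y x e
  ... | p , q' , sp , sq , convex with refl ← exit-unique (edge-sym e) sq q∈x q∉y
      with sp
  ... | ((s , (s∈W , _) , p∈s) , _) , _ = p , sp , p∈y , convex
    where
    p∈y : p ∈ Bag y
    p∈y with convex s x (inj₁ p∈s) (inj₂ q∈x) y (between⇒interval (nearer⇒between e s (W⇒nearer s∈W)))
    ... | inj₁ p∈y = p∈y
    ... | inj₂ q∈y = contradiction q∈y q∉y

  parallel-W : ∀ {a b c e} → Square a b c e → ∀ {v} → W D a b v → W D e c v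
  parallel-W s {v} v∈W = nearer⇒W (parallel s v (W⇒nearer v∈W))

  parallel-Z : ∀ {a b c e} → Square a b c e → ∀ {v} → Z D a b v → Z D e c v
  parallel-Z s (x , (x∈W , y , e , y∈W) , v∈x) =
    x , (parallel-W s x∈W , y , e , parallel-W (reflect s) y∈W) , v∈x

  opposite : ∀ {a b c e} → Square a b c e → Square e c b a
  opposite s = reflect (rotate (rotate s))

  -- By `parallel`, opposite edges have the same two sides, hence the same sets `Z`; `opposite` and
  -- `reflect` supply the four inclusions.
  parallel-SingletonDiff : ∀ {a b c e} → Square a b c e →
    ∀ {p} → SingletonDiff D a b p → SingletonDiff D e c p
  parallel-SingletonDiff s ((p∈ , p∉) , uniq) =
    (parallel-Z s p∈ , p∉ ∘ parallel-Z (reflect (opposite s))) ,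
    λ v v∈ v∉ → uniq v (parallel-Z (opposite s) v∈) (v∉ ∘ parallel-Z (reflect s))

  -- If q lay in neither y nor y', both pairs of parallel edges of the square would bring in q. The partner p
  -- of q across yx then also lies in w, and convexity of the bags meeting {p , q} puts q into y'.
  entrance-unique : ∀ {w y x y' q} → Square w y x y' → q ∈ Bag x → ¬ q ∈ Bag y → q ∈ Bag y'
  entrance-unique {w} {y} {x} {y'} {q} s q∈x q∉y with q ∈? Bag y'
  ... | yes q∈y' = q∈y'
  ... | no q∉y' with partner (bc s) q∈x q∉y | smooth x y' (ce s)
  ... | p , ((_ , p∉Zxy) , _) , p∈y , convex | r , _ , sr , _ with refl ← exit-unique (ce s) sr q∈x q∉y'
      = q∈y'
    where
    p∈w : p ∈ Bag w
    -- Otherwise `p` leaves across `yw`. This edge is parallel to `xy'`, where `q` leaves, so `p`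
    -- would be `q`, which is not in the bag of `y`.
    p∈w = decidable-stable (p ∈? Bag w) λ p∉w →
      q∉y (subst (_∈ Bag y)
        (exit-unique (edge-sym (ab s)) (parallel-SingletonDiff (rotate (rotate s)) sr) p∈y p∉w) p∈y)

    q∈y' : q ∈ Bag y'
    q∈y' with convex w x (inj₁ p∈w) (inj₂ q∈x) y'
                (between⇒interval (midpoint (edge-sym (ea s)) (edge-sym (ce s)) (a≢c s)))
    -- `y'w` is parallel to `xy`, so `p` in the bag of `y'` would put `p` into `Z D x y`, which the
    -- vertex exchanged for `q` avoids.
    ... | inj₁ p∈y' = contradiction (parallel-Z (rotate (rotate (rotate s))) (∈⇒Z (ea s) p∈y')) p∉Zxy
    ... | inj₂ q∈y' = q∈y'

  -- The decomposition rooted at a vertex of the median graph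

  module Rooted (z : V) where

    nearest : ∀ v a → v ∈ Bag a → ∃[ g ] (v ∈ Bag g × (∀ b → v ∈ Bag b → d z g ≤ d z b))
    nearest v a = go a (<-wellFounded (d z a))
      where
      go : ∀ a → Acc _<_ (d z a) → v ∈ Bag a → ∃[ g ] (v ∈ Bag g × (∀ b → v ∈ Bag b → d z g ≤ d z b))
      go a (acc rec) v∈a with Fin.any? (λ b → (v ∈? Bag b) ×-dec (d z b <? d z a))
      ... | yes (b , v∈b , lt) = go b (rec lt) v∈b
      ... | no none = a , v∈a , λ b v∈b → ≮⇒≥ λ lt → none (b , v∈b , lt)

    gate-spec : ∀ v → ∃[ g ] (v ∈ Bag g × (∀ b → v ∈ Bag b → d z g ≤ d z b))
    gate-spec v = nearest v (proj₁ (M2-nonempty D v)) (proj₂ (M2-nonempty D v))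

    gate : Fin n → V
    gate v = proj₁ (gate-spec v)

    ∈gate : ∀ v → v ∈ Bag (gate v)
    ∈gate v = proj₁ (proj₂ (gate-spec v))

    depth : Fin n → ℕ
    depth v = d z (gate v)

    depth≤ : ∀ {v b} → v ∈ Bag b → depth v ≤ d z b
    depth≤ {v} = proj₂ (proj₂ (gate-spec v)) _

    ∉-above : ∀ {v y} → depth v ≡ suc (d z y) → ¬ v ∈ Bag y
    ∉-above {v} {y} eq v∈y = 1+n≰n (subst (_≤ d z y) eq (depth≤ v∈y))

    -- p is the vertex that v replaces when its bags are first entered from z.
    Parent : Fin n → Fin n → Set
    Parent v p = ∃[ y ] (Edge (M D) y (gate v) × depth v ≡ suc (d z y) × SingletonDiff D y (gate v) p × p ∈ Bag y)

    -- Vertices of the bag of `z` are their own parents, so that iterating `parent` becomes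
    -- stationary there.
    parent-spec : ∀ v → ∃[ p ] ((v ∈ Bag z × p ≡ v) ⊎ Parent v p)
    parent-spec v with depth v in eq
    ... | zero = v , inj₁ (subst (λ a → v ∈ Bag a) (sym (d≡0⇒≡ eq)) (∈gate v) , refl)
    ... | suc k with step-towards (trans (d-sym (gate v) z) eq)
    ... | y , e , dyz with partner (edge-sym e) (∈gate v) (∉-above (trans eq (cong suc (trans (sym dyz) (d-sym y z)))))
    ... | p , sp , p∈y , _ =
      p , inj₂ (y , edge-sym e , cong suc (trans (sym dyz) (d-sym y z)) , sp , p∈y)

    parent : Fin n → Fin n
    parent v = proj₁ (parent-spec v)

    -- The number is fuel: `parent` lowers the depth of a vertex outside the bag of `z`, so
    -- `depth v` iterations reach that bag.
    ancestor : ℕ → Fin n → Fin n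
    ancestor zero    v = v
    ancestor (suc k) v = ancestor k (parent v)

    depth-of-root : ∀ {v} → v ∈ Bag z → depth v ≡ 0
    depth-of-root v∈z = n≤0⇒n≡0 (≤-trans (depth≤ v∈z) (≤-reflexive (d-refl z)))

    parent-fixes : ∀ {v} → v ∈ Bag z → parent v ≡ v
    parent-fixes {v} v∈z with parent-spec v
    ... | p , inj₁ (_ , eq) = eq
    ... | p , inj₂ (_ , _ , eq , _) = case trans (sym eq) (depth-of-root v∈z) of λ ()

    ancestor-fixes : ∀ k {v} → v ∈ Bag z → ancestor k v ≡ v
    ancestor-fixes zero    v∈z = refl
    ancestor-fixes (suc k) v∈z = trans (cong (ancestor k) (parent-fixes v∈z)) (ancestor-fixes k v∈z)

    parent-depth : ∀ {v k} → ¬ v ∈ Bag z → depth v ≤ suc k → depth (parent v) ≤ k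
    parent-depth {v} v∉z le with parent-spec v
    ... | p , inj₁ (v∈z , _) = contradiction v∈z v∉z
    ... | p , inj₂ (y , _ , eq , _ , p∈y) = ≤-trans (depth≤ p∈y) (s≤s⁻¹ (≤-trans (≤-reflexive (sym eq)) le))

    depth≤0⇒∈ : ∀ {v} → depth v ≤ 0 → v ∈ Bag z
    depth≤0⇒∈ {v} le = subst (λ a → v ∈ Bag a) (sym (d≡0⇒≡ (n≤0⇒n≡0 le))) (∈gate v)

    -- This makes `root v` and `root (parent v)` comparable, although they iterate different numbers
    -- of times.
    ancestor-stable : ∀ k l {v} → depth v ≤ k → depth v ≤ l → ancestor k v ≡ ancestor l v
    ancestor-stable k l {v} ≤k ≤l with v ∈? Bag z
    ancestor-stable k l ≤k ≤l | yes v∈z = trans (ancestor-fixes k v∈z) (sym (ancestor-fixes l v∈z))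
    ancestor-stable zero _ ≤k ≤l | no v∉z = contradiction (depth≤0⇒∈ ≤k) v∉z
    ancestor-stable (suc _) zero ≤k ≤l | no v∉z = contradiction (depth≤0⇒∈ ≤l) v∉z
    ancestor-stable (suc k) (suc l) ≤k ≤l | no v∉z =
      ancestor-stable k l (parent-depth v∉z ≤k) (parent-depth v∉z ≤l)

    ancestor∈ : ∀ k {v} → depth v ≤ k → ancestor k v ∈ Bag z
    ancestor∈ zero    ≤k = depth≤0⇒∈ ≤k
    ancestor∈ (suc k) {v} ≤k with v ∈? Bag z
    ... | yes v∈z = subst (_∈ Bag z) (sym (ancestor-fixes (suc k) v∈z)) v∈z
    ... | no  v∉z = ancestor∈ k (parent-depth v∉z ≤k)

    root : Fin n → Fin n
    root v = ancestor (depth v) v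

    root∈ : ∀ v → root v ∈ Bag z
    root∈ v = ancestor∈ (depth v) ≤-refl

    root-parent : ∀ {v} → ¬ v ∈ Bag z → root (parent v) ≡ root v
    root-parent {v} v∉z =
      trans (ancestor-stable (depth (parent v)) (depth v) ≤-refl (parent-depth v∉z (n≤1+n _)))
            (ancestor-stable (suc (depth v)) (depth v) (n≤1+n _) ≤-refl)

    -- `parent` uses one chosen neighbour of the gate nearer to `z`. A second one would span a
    -- square with it, and `entrance-unique` would put `q` into a bag nearer to `z` than its gate.
    entrance-pair : ∀ {q y p} → Edge (M D) y (gate q) → depth q ≡ suc (d z y) →
                    SingletonDiff D y (gate q) p → parent q ≡ p
    entrance-pair {q} {y} e eq sp with parent-spec q
    ... | _ , inj₁ (q∈z , _) = case trans (sym eq) (depth-of-root q∈z) of λ ()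
    ... | _ , inj₂ (y' , e' , eq' , sp' , _) with y Fin.≟ y'
    ...   | yes refl = SingletonDiff-unique sp' sp
    ...   | no y≢y' with quadrangle z (edge-sym e) (edge-sym e') y≢y' eq eq'
    ...     | _ , s , _ = contradiction (entrance-unique s (∈gate q) (∉-above eq)) (∉-above eq')

    -- The first step from `x` to the median `c` of `x`, the gate and `z` heads for the gate, so `q`
    -- stays in the bag, and also for `z`. If `c` is `x`, then `x` lies between the gate and `z`,
    -- and minimality of the gate gives equality.
    approach-gate : ∀ {q x} → q ∈ Bag x →
                    gate q ≡ x ⊎ ∃[ x' ] (Edge (M D) x x' × d z x ≡ suc (d z x') × q ∈ Bag x')
    approach-gate {q} {x} q∈x with median-exists x (gate q) z
    ... | c , x-c-g , g-c-z , z-c-x with d x c in dxc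
    ... | zero with refl ← d≡0⇒≡ dxc = inj₁ (d≡0⇒≡ (n≤0⇒n≡0 (+-cancelʳ-≤ (d x z) _ _ (begin
        d (gate q) x + d x z ≡⟨ g-c-z ⟩
        d (gate q) z         ≡⟨ d-sym (gate q) z ⟩
        depth q              ≤⟨ depth≤ q∈x ⟩
        d z x                ≡⟨ d-sym z x ⟩
        d x z                ∎))))
      where open ≤-Reasoning
    ... | suc k with step-towards dxc
    ... | x' , e , dx'c = inj₂ (x' , e , zx , q∈x')
      where
      x-x'-c : Between x x' c
      x-x'-c = trans (cong₂ _+_ (edge⇒d≡1 e) dx'c) (sym dxc)

      q∈x' : q ∈ Bag x'
      q∈x' = M2-convex D q x (gate q) q∈x (∈gate q) x'
               (between⇒interval (between-trans (trans (cong (_+ d c (gate q)) dxc) x-c-g) x-x'-c))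

      zx : d z x ≡ suc (d z x')
      zx = trans (sym (between-sym (between-trans (between-sym z-c-x) x-x'-c)))
                 (trans (cong (d z x' +_) (edge⇒d≡1 (edge-sym e))) (+-comm _ 1))

    -- Moving x towards the gate of q crosses squares that keep the exchanged pair (p , q); at the gate, p is
    -- the parent of q.
    root-exchange : ∀ {y x p q} → Acc _<_ (d z x) → Edge (M D) y x → d z x ≡ suc (d z y) →
                    q ∈ Bag x → ¬ q ∈ Bag y → SingletonDiff D y x p → root p ≡ root q
    root-exchange {q = q} (acc rec) e eq q∈x q∉y sp with approach-gate q∈x
    ... | inj₁ refl = trans (cong root (sym (entrance-pair e eq sp)))
                            (root-parent λ q∈z → case trans (sym (depth-of-root q∈z)) eq of λ ())
    ... | inj₂ (x' , e' , zx , q∈x') with quadrangle z (edge-sym e) e' (λ { refl → q∉y q∈x' }) eq zx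
    ... | w , s , zy = root-exchange (rec (≤-reflexive (sym zx))) (edge-sym (ea s))
                         (trans (suc-injective (trans (sym zx) eq)) zy) q∈x' q∉w
                         (parallel-SingletonDiff (rotate s) sp)
      where
      q∉w : ¬ q ∈ Bag w
      -- `wx'` is parallel to `yx`, so `q` in the bag of `w` would put `q` into `Z D y x`, which it
      -- avoids because it leaves from `x` to `y`.
      q∉w q∈w = exit⇒∉Z (edge-sym e) q∈x q∉y
                  (parallel-Z (reflect (rotate (rotate (rotate s)))) (∈⇒Z (edge-sym (ea s)) q∈w))

    -- Induction on the distance from `z`: the bag of a neighbour `y` nearer to `z` misses at most
    -- one vertex of the bag of `x`.
    root-injective : ∀ x {u v} → u ∈ Bag x → v ∈ Bag x → root u ≡ root v → u ≡ v
    root-injective x = go x refl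
      where
      go : ∀ {k} x → d z x ≡ k → ∀ {u v} → u ∈ Bag x → v ∈ Bag x → root u ≡ root v → u ≡ v
      -- The partner `p` of `v` has the root of `v`, hence that of `u`, and shares the bag of `y`
      -- with `u`. By induction `p` is `u`; but `u` is still in the bag of `x`, whereas `p` avoids
      -- `Z D x y`.
      mixed : ∀ {k x y u v} → Edge (M D) x y → d z x ≡ suc k → d y z ≡ k → u ∈ Bag x → v ∈ Bag x →
              u ∈ Bag y → ¬ v ∈ Bag y → root u ≢ root v

      go {zero} x eq {u} {v} u∈x v∈x ru≡rv with refl ← d≡0⇒≡ eq =
        trans (sym (ancestor-fixes (depth u) u∈x)) (trans ru≡rv (ancestor-fixes (depth v) v∈x))
      go {suc k} x eq {u} {v} u∈x v∈x ru≡rv with step-towards (trans (d-sym x z) eq)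
      ... | y , xy , dyz with u ∈? Bag y | v ∈? Bag y
      ... | yes u∈y | yes v∈y = go y (trans (d-sym z y) dyz) u∈y v∈y ru≡rv
      ... | no u∉y  | no v∉y  = trans (exit-unique xy sx u∈x u∉y) (sym (exit-unique xy sx v∈x v∉y))
        where sx = proj₁ (proj₂ (proj₂ (smooth x y xy)))
      ... | yes u∈y | no v∉y  = contradiction ru≡rv (mixed xy eq dyz u∈x v∈x u∈y v∉y)
      ... | no u∉y  | yes v∈y = contradiction (sym ru≡rv) (mixed xy eq dyz v∈x u∈x v∈y u∉y)

      mixed {k} {x} {y} xy eq dyz u∈x v∈x u∈y v∉y ru≡rv with partner (edge-sym xy) v∈x v∉y
      ... | p , sp@((_ , p∉Z) , _) , p∈y , _
        with refl ← go y (trans (d-sym z y) dyz) u∈y p∈y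
                      (trans ru≡rv (sym (root-exchange (<-wellFounded _) (edge-sym xy)
                        (trans eq (cong suc (trans (sym dyz) (d-sym y z)))) v∈x v∉y sp))) =
        p∉Z (∈⇒Z xy u∈x)

-- Colourings from decompositions, and minimal colourings

index : ∀ {n} (p : Subset n) {x} → x ∈ p → Fin ∣ p ∣
index (inside  ∷ p) here      = zero
index (inside  ∷ p) (there h) = suc (index p h)
index (outside ∷ p) (there h) = index p h

index-injective : ∀ {n} (p : Subset n) {x y} (h : x ∈ p) (h' : y ∈ p) → index p h ≡ index p h' → x ≡ y
index-injective (inside  ∷ p) here      here       eq = refl
index-injective (inside  ∷ p) (there h) (there h') eq = cong suc (index-injective p h h' (Fin.suc-injective eq))
index-injective (outside ∷ p) (there h) (there h') eq = cong suc (index-injective p h h' eq)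

∣X∣≤width : ∀ {n} {G : Graph n} (D : MedianDecomposition G) a → ∣ X D a ∣ ≤ width D
∣X∣≤width D a = foldr-preservesᵒ {P = ∣ X D a ∣ ≤_} (λ x y → [ m≤n⇒m≤n⊔o y , m≤n⇒m≤o⊔n x ]′) 0 _
  (inj₂ (lose (∈-map⁺ (λ a → ∣ X D a ∣) (∈-allFin a)) ≤-refl))

smooth⇒colourable : ∀ {n} {G : Graph n} (D : MedianDecomposition G) → ThetaSmooth D → Colourable G (width D)
-- Without vertices in `G` the graph `M` may be empty, leaving no base vertex.
smooth⇒colourable {zero}  D smooth = (λ ()) , λ ()
smooth⇒colourable {suc n} {G} D smooth = colour , proper
  where
  z = proj₁ (M2-nonempty D zero)
  open Smooth D smooth
  open Rooted z

  colour : Fin (suc n) → Fin (width D)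
  colour v = inject≤ (index (X D z) (root∈ v)) (∣X∣≤width D z)

  proper : ∀ u v → Edge G u v → colour u ≢ colour v
  proper u v e eq with M1 D u v e
  ... | a , u∈a , v∈a = Walks.edge⇒≢ G e (root-injective a u∈a v∈a
          (index-injective (X D z) (root∈ u) (root∈ v) (Fin.inject≤-injective _ _ _ _ eq)))

-- Decidability makes the least number of colours constructible. Colourings are enumerated by codes
-- in a `Fin`; decoding returns `c` only pointwise, so properness has to be transported.
colourable? : ∀ {n} (G : Graph n) k → Dec (Colourable G k)
colourable? {n} G k = map′ (λ (i , proper) → finToFun i , proper) encode (Fin.any? (λ i → proper? (finToFun i)))
  where
  Proper : (Fin n → Fin k) → Set
  Proper c = ∀ u v → Edge G u v → c u ≢ c v

  proper? : ∀ c → Dec (Proper c)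
  proper? c = Fin.all? λ u → Fin.all? λ v → (adj G u v Bool.≟ true) →-dec ¬? (c u Fin.≟ c v)

  encode : Colourable G k → ∃[ i ] Proper (finToFun i)
  encode (c , proper) = funToFin c , λ u v e eq → proper u v e
    (trans (sym (Fin.finToFun-funToFin c u)) (trans eq (Fin.finToFun-funToFin c v)))

minimum : ∀ {P : ℕ → Set} → (∀ k → Dec (P k)) → ∀ {n} → P n → ∃[ k ] IsMinimum P k
minimum {P} P? {n} pn = go n (<-wellFounded n) pn
  where
  go : ∀ n → Acc _<_ n → P n → ∃[ k ] IsMinimum P k
  go n (acc rec) pn with anyUpTo? P? n
  ... | yes (k , k<n , pk) = go k (rec k<n) pk
  ... | no none            = n , pn , λ j pj → ≮⇒≥ λ j<n → none (j , j<n , pj)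

chromatic : ∀ {n} (G : Graph n) → ∃[ k ] IsMinimum (Colourable G) k
chromatic G = minimum (colourable? G) ((λ v → v) , λ u v → Walks.edge⇒≢ G)

-- A colour that is never taken could be punched out, leaving one colour fewer than the minimum.
minimum-colouring-surjective : ∀ {n k} {G : Graph n} → (∀ j → Colourable G j → k ≤ j) →
  ((c , _) : Colourable G k) → ∀ i → ∃[ v ] c v ≡ i
minimum-colouring-surjective {k = suc k} minimal (c , proper) i =
  decidable-stable (Fin.any? λ v → c v Fin.≟ i) λ missed →
    let i≢c : ∀ v → i ≢ c v
        i≢c v eq = missed (v , sym eq)
    in 1+n≰n (minimal k ((λ v → punchOut (i≢c v)) ,
         λ u v e eq → proper u v e (Fin.punchOut-injective (i≢c u) (i≢c v) eq)))

-- Betweenness and sums of natural numbers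

Btw : ℕ → ℕ → ℕ → Set
Btw a t b = ∣ a - t ∣ + ∣ t - b ∣ ≡ ∣ a - b ∣

Btw-sym : ∀ a t b → Btw a t b → Btw b t a
Btw-sym a t b eq = trans (cong₂ _+_ (∣-∣-comm b t) (∣-∣-comm t a))
  (trans (+-comm ∣ t - b ∣ ∣ a - t ∣) (trans eq (∣-∣-comm a b)))

Btw-left : ∀ a b → Btw a a b
Btw-left a b = cong (_+ ∣ a - b ∣) (∣n-n∣≡0 a)

Btw-right : ∀ a b → Btw a b b
Btw-right a b = Btw-sym b b a (Btw-left b a)

≤⇒Btw : ∀ {a t b} → a ≤ t → t ≤ b → Btw a t b
≤⇒Btw {t = t} z≤n t≤b = trans (cong (t +_) (m≤n⇒∣m-n∣≡n∸m t≤b)) (m+[n∸m]≡n t≤b)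
≤⇒Btw (s≤s p) (s≤s q) = ≤⇒Btw p q

-- `bound` keeps a coordinatewise median inside the grid, whose coordinates are bounded by `size`.
record Med (a b c : ℕ) : Set where
  field
    t      : ℕ
    a-t-b  : Btw a t b
    b-t-c  : Btw b t c
    c-t-a  : Btw c t a
    unique : ∀ u → Btw a u b → Btw b u c → Btw c u a → u ≡ t
    bound  : ∀ {s} → a < s → b < s → c < s → t < s

Med-rotate : ∀ {a b c} → Med a b c → Med b c a
Med-rotate M = record { t = t ; a-t-b = b-t-c ; b-t-c = c-t-a ; c-t-a = a-t-b
  ; unique = λ u p q r → unique u r p q ; bound = λ p q r → bound r p q }
  where open Med M

Btw⇒Med : ∀ {a b c} → Btw a b c → Med a b c
Btw⇒Med {a} {b} {c} a-b-c = record
  { t = b ; a-t-b = Btw-right a b ; b-t-c = Btw-left b c ; c-t-a = Btw-sym a b c a-b-c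
  ; unique = unique ; bound = λ _ b<s _ → b<s }
  where
  unique : ∀ u → Btw a u b → Btw b u c → Btw c u a → u ≡ b
  -- The first two equations add up to `∣ a - c ∣`, as `b` is in the middle. The terms `∣ a - u ∣`
  -- and `∣ u - c ∣` already make up `∣ a - c ∣`, so nothing is left for the two distances between
  -- `u` and `b`.
  unique u a-u-b b-u-c c-u-a = ∣m-n∣≡0⇒m≡n (m+n≡0⇒m≡0 ∣ u - b ∣ (+-cancelˡ-≡ (∣ a - u ∣ + ∣ u - c ∣) _ 0 (begin
    ∣ a - u ∣ + ∣ u - c ∣ + (∣ u - b ∣ + ∣ b - u ∣)   ≡⟨ regroup ∣ a - u ∣ ∣ u - c ∣ ∣ u - b ∣ ∣ b - u ∣ ⟩
    ∣ a - u ∣ + ∣ u - b ∣ + (∣ b - u ∣ + ∣ u - c ∣)   ≡⟨ cong₂ _+_ a-u-b b-u-c ⟩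
    ∣ a - b ∣ + ∣ b - c ∣                             ≡⟨ a-b-c ⟩
    ∣ a - c ∣                                         ≡⟨ Btw-sym c u a c-u-a ⟨
    ∣ a - u ∣ + ∣ u - c ∣                             ≡⟨ +-identityʳ _ ⟨
    ∣ a - u ∣ + ∣ u - c ∣ + 0                         ∎)))
    where
    open ≡-Reasoning
    open +-*-Solver using (solve; _:+_; _:=_)
    regroup : ∀ p q r s → p + q + (r + s) ≡ p + r + (s + q)
    regroup = solve 4 (λ p q r s → p :+ q :+ (r :+ s) := p :+ r :+ (s :+ q)) refl

-- Of the three cyclic comparisons two have the same direction, and the number that they share is
-- the median.
med : ∀ a b c → Med a b c
med a b c with ≤-total a b | ≤-total b c | ≤-total c a
... | inj₁ a≤b | inj₁ b≤c | _        = Btw⇒Med (≤⇒Btw a≤b b≤c)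
... | inj₂ b≤a | inj₂ c≤b | _        = Btw⇒Med (Btw-sym c b a (≤⇒Btw c≤b b≤a))
... | _        | inj₁ b≤c | inj₁ c≤a = Med-rotate (Med-rotate (Btw⇒Med (≤⇒Btw b≤c c≤a)))
... | _        | inj₂ c≤b | inj₂ a≤c = Med-rotate (Med-rotate (Btw⇒Med (Btw-sym a c b (≤⇒Btw a≤c c≤b))))
... | inj₁ a≤b | _        | inj₁ c≤a = Med-rotate (Btw⇒Med (≤⇒Btw c≤a a≤b))
... | inj₂ b≤a | _        | inj₂ a≤c = Med-rotate (Btw⇒Med (Btw-sym b a c (≤⇒Btw b≤a a≤c)))

step-between : ∀ a b {l} → ∣ a - b ∣ ≡ suc l →
  ∃[ t ] (∣ a - t ∣ ≡ 1 × ∣ t - b ∣ ≡ l × (∀ {s} → a < s → b < s → t < s))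
step-between zero    (suc b) refl = 1 , refl , refl , λ { _ b<s → ≤-trans (s≤s (s≤s z≤n)) b<s }
step-between (suc a) zero    refl = a , ∣1+n-n∣ a , ∣-∣-identityʳ a , λ a<s _ → <⇒≤ a<s
  where
  ∣1+n-n∣ : ∀ n → ∣ suc n - n ∣ ≡ 1
  ∣1+n-n∣ zero    = refl
  ∣1+n-n∣ (suc n) = ∣1+n-n∣ n
step-between (suc a) (suc b) eq with step-between a b eq
... | t , p , q , bound = suc t , p , q , λ { (s≤s a<s) (s≤s b<s) → s≤s (bound a<s b<s) }

consecutive : ∀ a b → ∣ a - b ∣ ≡ 1 → b ≡ suc a ⊎ a ≡ suc b
consecutive zero    b       eq = inj₁ eq
consecutive (suc a) zero    eq = inj₂ eq
consecutive (suc a) (suc b) eq with consecutive a b eq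
... | inj₁ p = inj₁ (cong suc p)
... | inj₂ p = inj₂ (cong suc p)

nearer-low : ∀ x a → ∣ x - a ∣ < ∣ x - suc a ∣ → x ≤ a
nearer-low zero    a       lt = z≤n
nearer-low (suc x) zero    lt = contradiction (≤-trans lt (≤-reflexive (∣-∣-identityʳ x))) (1+n≰n ∘ <⇒≤)
nearer-low (suc x) (suc a) lt = s≤s (nearer-low x a lt)

nearer-high : ∀ x a → ∣ x - suc a ∣ < ∣ x - a ∣ → a < x
nearer-high zero    a       lt = contradiction lt (1+n≰n ∘ <⇒≤)
nearer-high (suc x) zero    lt = s≤s z≤n
nearer-high (suc x) (suc a) lt = s≤s (nearer-high x a lt)

crossing-up : ∀ {x a y} → x ≤ a → a < y → ∣ x - y ∣ ≤ 1 → x ≡ a × y ≡ suc a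
crossing-up {x} {a} {y} x≤a a<y le = ≤-antisym x≤a (s≤s⁻¹ (≤-trans a<y y≤1+x)) ,
                                     ≤-antisym (≤-trans y≤1+x (s≤s x≤a)) a<y
  where
  y≤1+x : y ≤ suc x
  y≤1+x = ≤-trans (m≤n+∣n-m∣ y x) (≤-trans (+-monoʳ-≤ x le) (≤-reflexive (+-comm x 1)))

crossing : ∀ a b {x y} → ∣ a - b ∣ ≡ 1 → ∣ x - a ∣ < ∣ x - b ∣ → ∣ y - b ∣ < ∣ y - a ∣ → ∣ x - y ∣ ≤ 1 →
           x ≡ a × y ≡ b
crossing a b {x} {y} ab xa<xb yb<ya xy with consecutive a b ab
... | inj₁ refl = crossing-up (nearer-low x a xa<xb) (nearer-high y a yb<ya) xy
... | inj₂ refl with crossing-up (nearer-low y b yb<ya) (nearer-high x b xa<xb) (subst (_≤ 1) (∣-∣-comm x y) xy)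
...   | p , q = q , p

Btw-consecutive : ∀ {a b p q t} → ∣ a - b ∣ ≡ 1 → p ≡ a ⊎ p ≡ b → q ≡ a ⊎ q ≡ b → Btw p t q → t ≡ a ⊎ t ≡ b
Btw-consecutive {a} {b} {p} {q} {t} ab p∈ q∈ btw with ∣ p - t ∣ in pt | ∣ t - q ∣ in tq
... | zero  | _     = subst (λ r → r ≡ a ⊎ r ≡ b) (∣m-n∣≡0⇒m≡n pt) p∈
... | suc _ | zero  = subst (λ r → r ≡ a ⊎ r ≡ b) (sym (∣m-n∣≡0⇒m≡n tq)) q∈
-- If `t` differs from both `p` and `q`, these are at distance at least 2.
... | suc x | suc y = contradiction (≤-trans (≤-reflexive (trans (cong suc (sym (+-suc x y))) btw)) (close p∈ q∈))
                                    λ { (s≤s ()) }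
  where
  close : ∀ {p q} → p ≡ a ⊎ p ≡ b → q ≡ a ⊎ q ≡ b → ∣ p - q ∣ ≤ 1
  close (inj₁ refl) (inj₁ refl) = ≤-trans (≤-reflexive (∣n-n∣≡0 a)) z≤n
  close (inj₁ refl) (inj₂ refl) = ≤-reflexive ab
  close (inj₂ refl) (inj₁ refl) = ≤-reflexive (trans (∣-∣-comm b a) ab)
  close (inj₂ refl) (inj₂ refl) = ≤-trans (≤-reflexive (∣n-n∣≡0 b)) z≤n

sum-mono-≤ : ∀ {k} {f g : Vector ℕ k} → (∀ i → f i ≤ g i) → sum f ≤ sum g
sum-mono-≤ {zero}  le = z≤n
sum-mono-≤ {suc k} le = +-mono-≤ (le zero) (sum-mono-≤ (le ∘ suc))

sum-mono-< : ∀ {k} {f g : Vector ℕ k} → (∀ i → f i ≤ g i) → ∀ i → f i < g i → sum f < sum g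
sum-mono-< {suc k} le zero    lt = +-mono-<-≤ lt (sum-mono-≤ (le ∘ suc))
sum-mono-< {suc k} le (suc i) lt = +-mono-≤-< (le zero) (sum-mono-< (le ∘ suc) i lt)

sum-≡⇒≗ : ∀ {k} {f g : Vector ℕ k} → (∀ i → f i ≤ g i) → sum f ≡ sum g → f ≗ g
sum-≡⇒≗ le eq i with m≤n⇒m<n∨m≡n (le i)
... | inj₁ lt = contradiction eq (<⇒≢ (sum-mono-< le i lt))
... | inj₂ eq = eq

sum≡0 : ∀ {k} {f : Vector ℕ k} → sum f ≡ 0 → ∀ i → f i ≡ 0
sum≡0 {k} eq i = sym (sum-≡⇒≗ {f = const 0} (λ _ → z≤n) (trans (sum-replicate-zero k) (sym eq)) i)

sum≡suc : ∀ {k l} {f : Vector ℕ k} → sum f ≡ suc l → ∃[ i ] ∃[ p ] f i ≡ suc p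
sum≡suc {suc k} {f = f} eq with f zero in f0
... | suc p = zero , p , f0
... | zero with sum≡suc {k} eq
...   | i , p , fi = suc i , p , fi

sum-step : ∀ {k} {f g : Vector ℕ k} i → f i ≡ suc (g i) → (∀ j → j ≢ i → f j ≡ g j) → sum f ≡ suc (sum g)
sum-step {suc k} zero fi fj = cong₂ _+_ fi (sum-cong-≗ (λ j → fj (suc j) λ ()))
sum-step {suc k} {f} {g} (suc i) fi fj =
  trans (cong₂ _+_ (fj zero λ ()) (sum-step i fi (λ j j≢i → fj (suc j) (j≢i ∘ Fin.suc-injective))))
        (+-suc (g zero) _)

sum≡1⁺ : ∀ {k} {f : Vector ℕ k} i → f i ≡ 1 → (∀ j → j ≢ i → f j ≡ 0) → sum f ≡ 1
sum≡1⁺ {k} i fi fj = trans (sum-step i fi fj) (cong suc (sum-replicate-zero k))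

sum≡1⁻ : ∀ {k} {f : Vector ℕ k} → sum f ≡ 1 → ∃[ i ] (f i ≡ 1 × ∀ j → j ≢ i → f j ≡ 0)
sum≡1⁻ {k} {f} eq with sum≡suc {f = f} eq
... | i , p , fi = i , trans fi (cong suc (trans (sym gi) (g≡0 i))) , λ j j≢i → trans (sym (gj j j≢i)) (g≡0 j)
  where
  g : Vector ℕ k
  -- Lowering the positive term by one leaves the sum 0, so every term of `g` vanishes.
  g = updateAt f i (const p)

  gi : g i ≡ p
  gi = updateAt-updates i f

  gj : ∀ j → j ≢ i → g j ≡ f j
  gj j j≢i = updateAt-minimal j i f j≢i

  g≡0 : ∀ j → g j ≡ 0
  g≡0 = sum≡0 (suc-injective (trans (sym (sum-step i (trans fi (cong suc (sym gi))) (λ j j≢i → sym (gj j j≢i)))) eq))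

-- Numbering grid points and ranking colour classes

record Coordinates {k} (size : Vector ℕ k) : Set where
  field
    points     : ℕ
    coord      : Fin points → Vector ℕ k
    coord<     : ∀ x i → coord x i < size i
    injective  : ∀ {x y} → coord x ≗ coord y → x ≡ y
    surjective : ∀ f → (∀ i → f i < size i) → ∃[ x ] coord x ≗ f

-- The vertices of a `Graph` are elements of a `Fin`, so the points of the product are numbered in
-- mixed radix, one factor at a time.
coordinates : ∀ {k} (size : Vector ℕ k) → Coordinates size
coordinates {zero} size = record
  { points = 1 ; coord = λ _ () ; coord< = λ _ ()
  ; injective = λ { {zero} {zero} _ → refl } ; surjective = λ _ _ → zero , λ () }
coordinates {suc k} size = record
  { points = size zero * points ; coord = coord' ; coord< = coord'<
  ; injective = injective' ; surjective = surjective' }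
  where
  open Coordinates (coordinates (size ∘ suc))

  coord' : Fin (size zero * points) → Vector ℕ (suc k)
  coord' x zero    = Fin.toℕ (quotient {size zero} points x)
  coord' x (suc i) = coord (remainder {size zero} points x) i

  coord'< : ∀ x i → coord' x i < size i
  coord'< x zero    = Fin.toℕ<n (quotient {size zero} points x)
  coord'< x (suc i) = coord< (remainder {size zero} points x) i

  injective' : ∀ {x y} → coord' x ≗ coord' y → x ≡ y
  injective' {x} {y} eq = trans (sym (Fin.combine-remQuot {size zero} points x))
    (trans (cong₂ combine (Fin.toℕ-injective (eq zero)) (injective (eq ∘ suc)))
           (Fin.combine-remQuot {size zero} points y))

  surjective' : ∀ f → (∀ i → f i < size i) → ∃[ x ] coord' x ≗ f
  surjective' f f< with surjective (f ∘ suc) (f< ∘ suc)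
  ... | x , eq = combine t x , λ where
      zero    → trans (cong (Fin.toℕ ∘ proj₁) (Fin.remQuot-combine t x)) (Fin.toℕ-fromℕ< (f< zero))
      (suc i) → trans (cong (λ r → coord (proj₂ r) i) (Fin.remQuot-combine t x)) (eq i)
    where t = Fin.fromℕ< (f< zero)

-- `size i` is the number of vertices of colour `i`, and `rank` lists them as a path; colour and
-- rank together identify a vertex.
record Ranking {n k} (c : Fin n → Fin k) : Set where
  field
    size       : Vector ℕ k
    rank       : Fin n → ℕ
    rank<      : ∀ v → rank v < size (c v)
    injective  : ∀ {u v} → c u ≡ c v → rank u ≡ rank v → u ≡ v
    surjective : ∀ i {t} → t < size i → ∃[ v ] (c v ≡ i × rank v ≡ t)

ranking : ∀ {n k} (c : Fin n → Fin k) → Ranking c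
ranking {zero} c = record
  { size = const 0 ; rank = λ () ; rank< = λ () ; injective = λ { {()} } ; surjective = λ _ () }
ranking {suc n} {k} c = record
  { size = size' ; rank = rank' ; rank< = rank'< ; injective = injective' ; surjective = surjective' }
  where
  open Ranking (ranking (c ∘ suc))

  size' : Vector ℕ k
  size' = updateAt size (c zero) suc

  size'-zero : size' (c zero) ≡ suc (size (c zero))
  size'-zero = updateAt-updates (c zero) size

  size≤size' : ∀ i → size i ≤ size' i
  size≤size' i with i Fin.≟ c zero
  ... | yes refl = ≤-trans (n≤1+n _) (≤-reflexive (sym size'-zero))
  ... | no i≢c0  = ≤-reflexive (sym (updateAt-minimal i (c zero) size i≢c0))

  rank' : Fin (suc n) → ℕ
  -- The new vertex goes to the end of its class.
  rank' zero    = size (c zero)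
  rank' (suc v) = rank v

  rank'< : ∀ v → rank' v < size' (c v)
  rank'< zero    = ≤-reflexive (sym size'-zero)
  rank'< (suc v) = <-≤-trans (rank< v) (size≤size' _)

  injective' : ∀ {u v} → c u ≡ c v → rank' u ≡ rank' v → u ≡ v
  injective' {zero}  {zero}  eq eq' = refl
  injective' {zero}  {suc v} eq eq' = contradiction (trans (cong size (sym eq)) eq') (≢-sym (<⇒≢ (rank< v)))
  injective' {suc u} {zero}  eq eq' = contradiction (trans (cong size eq) (sym eq')) (≢-sym (<⇒≢ (rank< u)))
  injective' {suc u} {suc v} eq eq' = cong suc (injective eq eq')

  surjective' : ∀ i {t} → t < size' i → ∃[ v ] (c v ≡ i × rank' v ≡ t)
  surjective' i {t} t<size' with i Fin.≟ c zero
  ... | no i≢c0 with surjective i (subst (t <_) (updateAt-minimal i (c zero) size i≢c0) t<size')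
  ...   | v , p , q = suc v , p , q
  surjective' i {t} t<size' | yes refl with m≤n⇒m<n∨m≡n (s≤s⁻¹ (subst (t <_) size'-zero t<size'))
  ...   | inj₂ refl   = zero , refl , refl
  ...   | inj₁ t<size with surjective i t<size
  ...     | v , p , q = suc v , p , q

-- The grid of transversals of the colour classes

does⁻ : ∀ {P : Set} (p? : Dec P) → does p? ≡ true → P
does⁻ (yes p) _ = p

members : ∀ {n} (p : Subset n) → ∃[ f ] (Injective _≡_ _≡_ f × ∀ (i : Fin ∣ p ∣) → f i ∈ p)
members []            = (λ ()) , (λ { {()} }) , λ ()
members (outside ∷ p) with members p
... | f , f-inj , f∈ = suc ∘ f , f-inj ∘ Fin.suc-injective , there ∘ f∈
members {suc n} (inside ∷ p) with members p
... | f , f-inj , f∈ = g , g-inj , λ { zero → here ; (suc i) → there (f∈ i) }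
  where
  g : Fin (suc ∣ p ∣) → Fin (suc n)
  g zero    = zero
  g (suc i) = suc (f i)

  g-inj : Injective _≡_ _≡_ g
  g-inj {zero}  {zero}  _  = refl
  g-inj {suc i} {suc j} eq = cong suc (f-inj (Fin.suc-injective eq))

injectiveOn⇒∣p∣≤ : ∀ {n k} {p : Subset n} (c : Fin n → Fin k) →
                   (∀ {u v} → u ∈ p → v ∈ p → c u ≡ c v → u ≡ v) → ∣ p ∣ ≤ k
injectiveOn⇒∣p∣≤ {p = p} c inj with members p
... | f , f-inj , f∈ = Fin.injective⇒≤ {f = c ∘ f} (f-inj ∘ inj (f∈ _) (f∈ _))

-- An integer metric in which every positive distance can begin with a unit step is the distance of
-- the graph of its unit pairs.
module MetricGraph {m} (δ : Fin m → Fin m → ℕ)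
  (δ-refl     : ∀ x → δ x x ≡ 0)
  (δ≡0⇒≡      : ∀ {x y} → δ x y ≡ 0 → x ≡ y)
  (δ-sym      : ∀ x y → δ x y ≡ δ y x)
  (δ-triangle : ∀ x y z → δ x z ≤ δ x y + δ y z)
  (δ-step     : ∀ {x y k} → δ x y ≡ suc k → ∃[ z ] (δ x z ≡ 1 × δ z y ≡ k))
  where

  graph : Graph m
  graph = record
    { adj     = λ x y → does (δ x y ≟ 1)
    ; adj-sym = λ x y → cong (λ k → does (k ≟ 1)) (δ-sym x y)
    ; irrefl  = λ x → cong (λ k → does (k ≟ 1)) (δ-refl x)
    }

  private
    walk : ∀ k {x y} → δ x y ≡ k → Walk graph x y k
    walk zero    eq with refl ← δ≡0⇒≡ eq = here _
    walk (suc k) eq with δ-step eq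
    ... | z , xz , zy = step (dec-true (_ ≟ 1) xz) (walk k zy)

    δ≤ : ∀ {x y k} → Walk graph x y k → δ x y ≤ k
    δ≤ (here x) = ≤-reflexive (δ-refl x)
    δ≤ (step {u = x} {v = z} {w = y} e p) =
      ≤-trans (δ-triangle x z y) (+-mono-≤ (≤-reflexive (does⁻ (δ x z ≟ 1) e)) (δ≤ p))

  δ-dist : ∀ x y → Dist graph x y (δ x y)
  δ-dist x y = walk _ refl , λ _ → δ≤

  connected : Connected graph
  connected x y = δ x y , walk _ refl

module Grid {k} {size : Vector ℕ k} (C : Coordinates size) where
  open Coordinates C

  δ : Fin points → Fin points → ℕ
  δ x y = sum (λ i → ∣ coord x i - coord y i ∣)

  replace : ∀ x i {t} → t < size i → ∃[ y ] (coord y i ≡ t × (∀ j → j ≢ i → coord y j ≡ coord x j))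
  replace x i {t} t< with surjective (updateAt (coord x) i (const t)) bounded
    where
    bounded : ∀ j → updateAt (coord x) i (const t) j < size j
    bounded j with j Fin.≟ i
    ... | yes refl = subst (_< size j) (sym (updateAt-updates j (coord x))) t<
    ... | no j≢i   = subst (_< size j) (sym (updateAt-minimal j i (coord x) j≢i)) (coord< x j)
  ... | y , eq = y , trans (eq i) (updateAt-updates i (coord x)) ,
                 λ j j≢i → trans (eq j) (updateAt-minimal j i (coord x) j≢i)

  δ-refl : ∀ x → δ x x ≡ 0
  δ-refl x = trans (sum-cong-≗ (λ i → ∣n-n∣≡0 (coord x i))) (sum-replicate-zero k)

  δ≡0⇒≡ : ∀ {x y} → δ x y ≡ 0 → x ≡ y
  δ≡0⇒≡ eq = injective (λ i → ∣m-n∣≡0⇒m≡n (sum≡0 eq i))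

  δ-sym : ∀ x y → δ x y ≡ δ y x
  δ-sym x y = sum-cong-≗ (λ i → ∣-∣-comm (coord x i) (coord y i))

  δ-via : ∀ x y z → sum (λ i → ∣ coord x i - coord y i ∣ + ∣ coord y i - coord z i ∣) ≡ δ x y + δ y z
  δ-via x y z = ∑-distrib-+ (λ i → ∣ coord x i - coord y i ∣) (λ i → ∣ coord y i - coord z i ∣)

  δ-triangle : ∀ x y z → δ x z ≤ δ x y + δ y z
  δ-triangle x y z = ≤-trans (sum-mono-≤ (λ i → ∣-∣-triangle (coord x i) (coord y i) (coord z i)))
                             (≤-reflexive (δ-via x y z))

  δ-step : ∀ {x y l} → δ x y ≡ suc l → ∃[ z ] (δ x z ≡ 1 × δ z y ≡ l)
  δ-step {x} {y} eq with sum≡suc eq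
  ... | i , p , xyi with step-between (coord x i) (coord y i) xyi
  ... | t , xt , ty , bound with replace x i (bound (coord< x i) (coord< y i))
  ... | z , refl , z≡x =
    z , sum≡1⁺ i xt (λ j j≢i → m≡n⇒∣m-n∣≡0 (sym (z≡x j j≢i))) ,
    suc-injective (trans (sym (sum-step i (trans xyi (cong suc (sym ty)))
      (λ j j≢i → cong ∣_- coord y j ∣ (sym (z≡x j j≢i))))) eq)

  open MetricGraph δ δ-refl δ≡0⇒≡ δ-sym δ-triangle δ-step public
  open Distance graph δ δ-dist public
    using (Between; interval⇒between; between⇒interval; edge⇒d≡1; edge-sym)

  -- `δ` adds up over the coordinates, so equality in its triangle inequality forces equality in
  -- each coordinate.
  interval⇒Btw : ∀ {x y z} → InInterval graph x y z → ∀ i → Btw (coord x i) (coord z i) (coord y i)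
  interval⇒Btw {x} {y} {z} h i = sym (sum-≡⇒≗
    (λ i → ∣-∣-triangle (coord x i) (coord z i) (coord y i))
    (trans (sym (interval⇒between h)) (sym (δ-via x z y))) i)

  Btw⇒interval : ∀ {x y z} → (∀ i → Btw (coord x i) (coord z i) (coord y i)) → InInterval graph x y z
  Btw⇒interval {x} {y} {z} btw = between⇒interval (trans (sym (δ-via x z y)) (sum-cong-≗ btw))

  isMedian : IsMedian graph
  isMedian = connected , medians
    where
    medians : ∀ u v w → ∃[ z ] ((InInterval graph u v z × InInterval graph v w z × InInterval graph w u z)
      × (∀ z' → InInterval graph u v z' → InInterval graph v w z' → InInterval graph w u z' → z' ≡ z))
    medians u v w = z ,
      ( Btw⇒interval (λ i → subst (λ t → Btw (coord u i) t (coord v i)) (sym (z≡ i)) (a-t-b (meds i)))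
      , Btw⇒interval (λ i → subst (λ t → Btw (coord v i) t (coord w i)) (sym (z≡ i)) (b-t-c (meds i)))
      , Btw⇒interval (λ i → subst (λ t → Btw (coord w i) t (coord u i)) (sym (z≡ i)) (c-t-a (meds i)))) ,
      λ z' p q r → injective λ i →
        trans (unique (meds i) (coord z' i) (interval⇒Btw p i) (interval⇒Btw q i) (interval⇒Btw r i)) (sym (z≡ i))
      where
      open Med
      meds : ∀ i → Med (coord u i) (coord v i) (coord w i)
      meds i = med (coord u i) (coord v i) (coord w i)

      meet : ∃[ z ] (coord z ≗ t ∘ meds)
      meet = surjective (t ∘ meds) (λ i → bound (meds i) (coord< u i) (coord< v i) (coord< w i))

      z  = proj₁ meet
      z≡ = proj₂ meet

  edge⁻ : ∀ {a b} → Edge graph a b →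
          ∃[ i ] (∣ coord a i - coord b i ∣ ≡ 1 × (∀ j → j ≢ i → coord a j ≡ coord b j))
  edge⁻ {a} {b} e =
    let i , ab , same = sum≡1⁻ {f = λ i → ∣ coord a i - coord b i ∣} (edge⇒d≡1 e)
    in i , ab , λ j j≢i → ∣m-n∣≡0⇒m≡n (same j j≢i)

  -- The terms other than the `i`-th agree in the two sums, so the `i`-th alone decides.
  coord-nearer : ∀ {a b} i → (∀ j → j ≢ i → coord a j ≡ coord b j) → ∀ v → δ v a < δ v b →
                 ∣ coord v i - coord a i ∣ < ∣ coord v i - coord b i ∣
  coord-nearer {a} {b} i same v lt = ≰⇒> λ ≥ → <⇒≱ lt (sum-mono-≤ λ j → le ≥ j)
    where
    le : ∣ coord v i - coord b i ∣ ≤ ∣ coord v i - coord a i ∣ →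
         ∀ j → ∣ coord v j - coord b j ∣ ≤ ∣ coord v j - coord a j ∣
    le ≥ j with j Fin.≟ i
    ... | yes refl = ≥
    ... | no j≢i   = ≤-reflexive (cong (λ t → ∣ coord v j - t ∣) (sym (same j j≢i)))

module Transversals {n k} {G : Graph n} (c : Fin n → Fin k)
  (proper : ∀ u v → Edge G u v → c u ≢ c v) (section : ∀ i → ∃[ v ] c v ≡ i)
  (R : Ranking c) (C : Coordinates (Ranking.size R)) where

  open Ranking R renaming (injective to rank-injective; surjective to rank-surjective)
  open Coordinates C
  open Grid C

  bag? : ∀ x v → Dec (coord x (c v) ≡ rank v)
  bag? x v = coord x (c v) ≟ rank v

  bag : Fin points → Subset n
  bag x = tabulate (λ v → does (bag? x v))

  ∈bag⁺ : ∀ {x v} → coord x (c v) ≡ rank v → v ∈ bag x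
  ∈bag⁺ {x} {v} eq = lookup⇒[]= v (bag x) (trans (lookup∘tabulate _ v) (dec-true (bag? x v) eq))

  ∈bag⁻ : ∀ {x v} → v ∈ bag x → coord x (c v) ≡ rank v
  ∈bag⁻ {x} {v} h = does⁻ (bag? x v) (trans (sym (lookup∘tabulate _ v)) ([]=⇒lookup h))

  -- An empty colour class would be a factor without points and leave the grid empty; `section`
  -- excludes this.
  origin : Fin points
  origin = proj₁ (surjective (λ i → rank (proj₁ (section i)))
    (λ i → subst (λ j → rank (proj₁ (section i)) < size j) (proj₂ (section i)) (rank< (proj₁ (section i)))))

  in-bag : ∀ v → ∃[ x ] (v ∈ bag x)
  in-bag v with replace origin (c v) (rank< v)
  ... | x , eq , _ = x , ∈bag⁺ eq

  -- As `u` and `v` have different colours, setting the coordinate `c v` to `rank v` leaves alone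
  -- the coordinate that keeps `u` in the bag.
  in-common-bag : ∀ u v → Edge G u v → ∃[ x ] (u ∈ bag x × v ∈ bag x)
  in-common-bag u v e with in-bag u
  ... | x , u∈x with replace x (c v) (rank< v)
  ... | y , eq , same = y , ∈bag⁺ (trans (same (c u) (proper u v e)) (∈bag⁻ u∈x)) , ∈bag⁺ eq

  -- The bags of `v` form a layer of the grid, and a number between two equal ones equals both.
  bags-convex : ∀ v → Convex graph (λ x → v ∈ bag x)
  bags-convex v x y v∈x v∈y z h = ∈bag⁺ (trans (sym x≡z) (∈bag⁻ v∈x))
    where
    x≡z : coord x (c v) ≡ coord z (c v)
    x≡z = ∣m-n∣≡0⇒m≡n (m+n≡0⇒m≡0 _ (trans (interval⇒Btw h (c v))
            (m≡n⇒∣m-n∣≡0 (trans (∈bag⁻ v∈x) (sym (∈bag⁻ v∈y))))))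

  decomposition : MedianDecomposition G
  decomposition = record
    { m = points ; M = graph ; median = isMedian ; X = bag
    ; M1 = in-common-bag ; M2-nonempty = in-bag ; M2-convex = bags-convex }

  private D = decomposition

  open Sides D δ δ-dist

  vertexAt : ∀ x i → ∃[ v ] (c v ≡ i × rank v ≡ coord x i)
  vertexAt x i = rank-surjective i (coord< x i)

  ∈vertexAt⁻ : ∀ x i {y} → proj₁ (vertexAt x i) ∈ bag y → coord y i ≡ coord x i
  ∈vertexAt⁻ x i {y} h with vertexAt x i
  ... | v , refl , rv = trans (∈bag⁻ h) rv

  ∈vertexAt⁺ : ∀ x i {y} → coord y i ≡ coord x i → proj₁ (vertexAt x i) ∈ bag y
  ∈vertexAt⁺ x i {y} eq with vertexAt x i
  ... | v , refl , rv = ∈bag⁺ (trans eq (sym rv))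

  module Crossing {a b} (e : Edge graph a b) (i : Fin k) (ab : ∣ coord a i - coord b i ∣ ≡ 1)
                  (same : ∀ j → j ≢ i → coord a j ≡ coord b j) where

    -- An edge in another direction keeps the `i`-th coordinate, which cannot be nearer to
    -- `coord a i` and also nearer to `coord b i`; in direction `i`, `crossing` applies.
    crossing-edge : ∀ {x y} → W D a b x → Edge graph x y → W D b a y →
                    coord x i ≡ coord a i × coord y i ≡ coord b i × (∀ j → j ≢ i → coord x j ≡ coord y j)
    crossing-edge {x} {y} x∈W xy y∈W = let l , xyl , same' = edge⁻ xy in cases l xyl same'
      where
      x-nearer : ∣ coord x i - coord a i ∣ < ∣ coord x i - coord b i ∣
      x-nearer = coord-nearer i same x (W⇒nearer x∈W)

      y-nearer : ∣ coord y i - coord b i ∣ < ∣ coord y i - coord a i ∣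
      y-nearer = coord-nearer i (λ j j≢i → sym (same j j≢i)) y (W⇒nearer y∈W)

      cases : ∀ l → ∣ coord x l - coord y l ∣ ≡ 1 → (∀ j → j ≢ l → coord x j ≡ coord y j) →
              coord x i ≡ coord a i × coord y i ≡ coord b i × (∀ j → j ≢ i → coord x j ≡ coord y j)
      cases l xyl same' with i Fin.≟ l
      ... | yes refl = let xi , yi = crossing (coord a i) (coord b i) ab x-nearer y-nearer (≤-reflexive xyl)
                       in xi , yi , same'
      ... | no i≢l   = contradiction y-nearer (<-asym
        (subst (λ t → ∣ t - coord a i ∣ < ∣ t - coord b i ∣) (same' i i≢l) x-nearer))

    singletonDiff : SingletonDiff D a b (proj₁ (vertexAt a i))
    singletonDiff = ((a , (end∈W e , b , e , end∈W (edge-sym e)) , ∈vertexAt⁺ a i refl) , v∉Z) , unique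
      where
      v∉Z : ¬ Z D b a (proj₁ (vertexAt a i))
      v∉Z (x , (x∈W , y , xy , y∈W) , v∈x) =
        let _ , xi , _ = crossing-edge y∈W (edge-sym xy) x∈W
        in case trans (sym ab) (m≡n⇒∣m-n∣≡0 (trans (sym (∈vertexAt⁻ a i v∈x)) xi)) of λ ()

      unique : ∀ w → Z D a b w → ¬ Z D b a w → w ≡ proj₁ (vertexAt a i)
      unique w (x , (x∈W , y , xy , y∈W) , w∈x) w∉Z =
        let xi , _ , same' = crossing-edge x∈W xy y∈W
            _ , cv , rv    = vertexAt a i
            -- The edge `xy` changes only the coordinate `i`, so a vertex of another colour stays in
            -- the bag and lies in `Z D b a` as well.
            cw≡i = decidable-stable (c w Fin.≟ i) λ cw≢i → w∉Z
              (y , (y∈W , x , edge-sym xy , x∈W) , ∈bag⁺ (trans (sym (same' (c w) cw≢i)) (∈bag⁻ w∈x)))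
        in rank-injective (trans cw≡i (sym cv))
             (trans (sym (∈bag⁻ w∈x)) (trans (cong (coord x) cw≡i) (trans xi (sym rv))))

    -- The bags of the two vertices fill two consecutive layers in direction `i`, and no number lies
    -- strictly between consecutive ones.
    slab-convex : Convex graph (λ x → proj₁ (vertexAt a i) ∈ bag x ⊎ proj₁ (vertexAt b i) ∈ bag x)
    slab-convex x y x∈ y∈ z h = Sum.map (∈vertexAt⁺ a i) (∈vertexAt⁺ b i)
      (Btw-consecutive ab (to-slab x∈) (to-slab y∈) (interval⇒Btw h i))
      where
      to-slab : ∀ {x} → proj₁ (vertexAt a i) ∈ bag x ⊎ proj₁ (vertexAt b i) ∈ bag x →
                coord x i ≡ coord a i ⊎ coord x i ≡ coord b i
      to-slab = Sum.map (∈vertexAt⁻ a i) (∈vertexAt⁻ b i)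

  smooth : ThetaSmooth D
  smooth a b e =
    let i , ab , same = edge⁻ e
    in proj₁ (vertexAt a i) , proj₁ (vertexAt b i) , Crossing.singletonDiff e i ab same ,
       Crossing.singletonDiff (edge-sym e) i (trans (∣-∣-comm (coord b i) (coord a i)) ab)
         (λ j j≢i → sym (same j j≢i)) ,
       Crossing.slab-convex e i ab same

  -- Colour and the coordinates of `x` determine the rank, so a bag has at most one vertex of each
  -- colour. Equality comes from the lower bound.
  width≤ : width D ≤ k
  width≤ = foldr-preservesᵇ {P = _≤ k} ⊔-lub z≤n (All.map⁺ (All.tabulate⁺ {f = λ x → x} λ x →
    injectiveOn⇒∣p∣≤ c (λ u∈x v∈x eq → rank-injective eq
      (trans (sym (∈bag⁻ u∈x)) (trans (cong (coord x) eq) (∈bag⁻ v∈x))))))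

theorem4p3 : ∀ (n : ℕ) (G : Graph n) →
    Σ ℕ (λ k → IsMinimum (SmoothWidth G) k × IsMinimum (Colourable G) k)
theorem4p3 n G with chromatic G
... | k , colourable@(c , proper) , minimal =
  k , ((decomposition , smooth , ≤-antisym width≤ (k≤width decomposition smooth)) ,
       λ { _ (D , smooth , refl) → k≤width D smooth }) , colourable , minimal
  where
  open Transversals {G = G} c proper (minimum-colouring-surjective {G = G} minimal colourable)
    (ranking c) (coordinates _)

  k≤width : ∀ D → ThetaSmooth D → k ≤ width D
  k≤width D smooth = minimal (width D) (smooth⇒colourable D smooth)
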